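{- In the axiom system $\mathtt{TMM}\setminus\{\mathtt{spec},\mathtt{ALLeq}\}$, the scheme $\mathtt{ALLcomm}$ cannot be weakened by adding the disjoint variable condition $\mathrm{DV}(x,y)$ or $\mathrm{DV}(y,\phi)$: for each $D\in\{\{x,y\},\{y,\phi\}\}$, the scheme $\mathtt{ALLcomm}$ (i.e. $\forall x\forall y\,\phi\to\forall y\forall x\,\phi$ without disjoint variable conditions) is not provable from the set of schemes consisting of $\mathtt{TMM}\setminus\{\mathtt{spec},\mathtt{ALLeq},\mathtt{ALLcomm}\}$ together with the scheme $(\forall x\forall y\,\phi\to\forall y\forall x\,\phi,\ \{D\})$. In particular, $\mathtt{ALLcomm}$ is independent in $\mathtt{TMM}\setminus\{\mathtt{spec},\mathtt{ALLeq}\}$.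
   Context: **Metavariables and metaformulas.** Let $\mathrm{vrMV}=\{x_i\mid i\in\omega\}$ (variable metavariables) and $\mathrm{fmMV}=\{\phi_i\mid i\in\omega\}$ (formula metavariables) be disjoint countably infinite sets of symbols, and $\mathrm{MV}=\mathrm{vrMV}\cup\mathrm{fmMV}$. A language $\mathcal L$ is a set of further symbols (nonlogical predicates) with an arity function $\mathcal L\to\omega$. Fix a language $\mathcal L$. A metaformula is one of: a formula metavariable; $x_i\equiv x_j$; $P(x_{i_1},\dots,x_{i_r})$ with $P\in\mathcal L$ of arity $r$; $\forall x_i\,\Phi$; $\neg\Phi$; $\Phi\to\Psi$, where $\Phi,\Psi$ are metaformulas. $\mathrm{MF}$ is the set of metaformulas. $\mathrm{OC}(\Phi)\subseteq\mathrm{MV}$ is the set of metavariables occurring in $\Phi$ (including those directly after a quantifier), and $\mathrm{OC}(x_i)=\{x_i\}$. For a set $X$, $\mathcal P_2(X)$ is the set of its two-element subsets. **Schemes.** A scheme $\Phi=(\{\Phi_1,\dots,\Phi_n\},\Phi_0,\mathrm{DV}(\Phi))$ consists of a finite set of metaformulas (hypotheses), a metaformula (conclusion), and a set $\mathrm{DV}(\Phi)\subseteq\mathcal P_2(\mathrm{OC}(\Phi))$ (disjoint variable conditions), where $\mathrm{OC}(\Phi)$ is the set of metavariables occurring in its hypotheses or conclusion. Writing $(\Phi_I,\Phi_0,D)$ with a larger $D$ means that $D$ is intersected with $\mathcal P_2(\mathrm{OC}(\Phi))$. Such a scheme is displayed as $\Phi_1\;\&\;\dots\;\&\;\Phi_n\Longrightarrow\Phi_0,\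 \mathrm{DV}(\cdot,\cdot),\dots$, where $\mathrm{DV}(m,n)$ denotes the condition $\{m,n\}$; a scheme without hypotheses is written $(\Phi_0,\mathrm{DV}(\Phi))$. **Substitution and instances.** A substitution is a map $\sigma:\mathrm{MV}\to\mathrm{vrMV}\cup\mathrm{MF}$ with $\sigma(\mathrm{vrMV})\subseteq\mathrm{vrMV}$, $\sigma(\mathrm{fmMV})\subseteq\mathrm{MF}$ and $\sigma(m)=m$ for all but finitely many $m$. $\Phi^\sigma$ is the result of simultaneous plain substitution in the metaformula $\Phi$ (variable metavariables after quantifiers are also replaced). For $D\subseteq\mathcal P_2(\mathrm{MV})$, $D^\sigma=\{\{m,n\}\in\mathcal P_2(\mathrm{MV})\mid\exists\{m',n'\}\in D,\ m\in\mathrm{OC}(\sigma(m')),\ n\in\mathrm{OC}(\sigma(n'))\}$. $\sigma$ is legitimate on a scheme $\Phi$ if $\{m,n\}\in\mathrm{DV}(\Phi)$ implies $\mathrm{OC}(\sigma(m))\cap\mathrm{OC}(\sigma(n))=\varnothing$. A scheme $\Psi$ is an instance of $\Phi$ if for some $\sigma$ legitimate on $\Phi$ the hypotheses and conclusion of $\Psi$ are the images under $\sigma$ of those of $\Phi$ and $\mathrm{DV}(\Phi)^\sigma\subseteq\mathrm{DV}(\Psi)$. **Proofs.** A proof of a scheme $\Phi$ from a set of schemes $S$ is a finite sequence $P$ of metaformulas (lines) whose last line is the conclusion of $\Phi$ and such that each line $P_i$ that is not a hypothesis of $\Phi$ admits $i_1,\dots,i_n<i$ for which $(\{P_{i_1},\dots,P_{i_n}\},P_i,\mathrm{DV}(P))$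 is an instance of a scheme in $S$, where $\mathrm{DV}(P)=\mathrm{DV}(\Phi)\cup\{\{m,n\}\mid m\in\mathrm{OC}(P)\setminus\mathrm{OC}(\Phi),\ n\in\mathrm{OC}(P),\ m\ne n\}$ and $\mathrm{OC}(P)$ is the set of metavariables occurring in the lines of $P$ (or in $\Phi$). $\Phi$ is provable from $S$ if such a proof exists. A scheme is independent in a set of schemes containing it if it is not provable from the other schemes of that set. (Provability does not depend on the choice of the language containing the symbols involved.) **The system $\mathtt{TMM}$.** With $x,y,z$ distinct variable metavariables and $\phi,\psi,\chi,\theta,\tau$ distinct formula metavariables, $\mathtt{TMM}$ is the set of the following schemes: - $\mathtt{mp}$: $\phi\;\&\;\phi\to\psi\Longrightarrow\psi$ - $\mathtt{minimp}$: $\phi\to((\psi\to\chi)\to(((\theta\to\psi)\to(\chi\to\tau))\to(\psi\to\tau)))$ - $\mathtt{peirce}$: $((\phi\to\psi)\to\phi)\to\phi$ - $\mathtt{contrap}$: $(\phi\to\neg\psi)\to(\psi\to\neg\phi)$ - $\mathtt{notelim}$: $\neg\phi\to(\phi\to\psi)$ - $\mathtt{gen}$: $\phi\Longrightarrow\forall x\,\phi$ - $\mathtt{ALLdistr}$: $\forall x(\phi\to\psi)\to(\forall x\,\phi\to\forall x\,\psi)$ - $\mathtt{spec}$: $\forall x\,\phi\to\phi$ - $\mathtt{modal5}$: $\neg\forall x\,\phi\to\forall x\,\neg\forall x\,\phi$ - $\mathtt{vacGen}$: $\phi\to\forall x\,\phi,\ \mathrm{DV}(x,\phi)$ - $\mathtt{ALLcomm}$: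 $\forall x\forall y\,\phi\to\forall y\forall x\,\phi$ - $\mathtt{EQrefl}$: $x\equiv x$ - $\mathtt{EQsymm}$: $x\equiv y\to y\equiv x$ - $\mathtt{EQtrans}$: $x\equiv y\to(y\equiv z\to x\equiv z)$ - $\mathtt{denot}$: $x\equiv x\to\neg\forall y\,\neg\,y\equiv x,\ \mathrm{DV}(x,y)$ - $\mathtt{subst}$: $\forall x(x\equiv y\to(\phi\to\forall x(x\equiv y\to\phi))),\ \mathrm{DV}(x,y),\ \mathrm{DV}(y,\phi)$ - $\mathtt{ALLeq}$: $\forall x\,x\equiv y\to(\forall x\,\phi\to\forall y\,\phi)$ - $\mathtt{genEq}$: $\neg\forall x\,x\equiv y\to(\neg\forall x\,x\equiv z\to(y\equiv z\to\forall x\,y\equiv z))$ -}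

module Defs where

open import Data.Fin.Base using (Fin; fromℕ)
import Data.Fin.Base as Fin
open import Data.List.Base using (List; []; _∷_; _++_; map; concatMap; allFin)
open import Data.List.Membership.Propositional using (_∈_; _∉_)
open import Data.List.Relation.Binary.BagAndSetEquality using (_∼[_]_; set)
open import Data.List.Relation.Binary.Disjoint.Propositional using (Disjoint)
open import Data.List.Relation.Unary.All using (All)
open import Data.List.Relation.Unary.Any using (Any)
open import Data.Nat.Base using (ℕ; suc)
open import Data.Product.Base using (_×_; _,_; ∃-syntax; proj₁)
open import Data.Sum.Base using (_⊎_; swap)
open import Data.Vec.Base using (Vec; toList)
import Data.Vec.Base as Vec
open import Data.Vec.Functional using (Vector)
open import Function.Base using (_∘_)
open import Function.Bundles using (_⇔_)
open import Level using (0ℓ) renaming (suc to lsuc)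
import Relation.Unary as Unary
open import Relation.Binary.Core using (Rel; _⇒_)
open import Relation.Binary.Definitions using (Symmetric)
open import Relation.Binary.PropositionalEquality using (_≡_; _≢_; ≢-sym)
open import Relation.Nullary using (¬_)

record Language : Set₁ where
  field
    Predicate : Set
    arity     : Predicate → ℕ

data MV : Set where
  vr : ℕ → MV
  fm : ℕ → MV

-- A set of two-element subsets of MV is encoded as a symmetric relation on MV
-- contained in 𝒫₂ X, where X ranges over finite sets given as lists.
𝒫₂ : List MV → Rel MV 0ℓ
𝒫₂ X m n = m ≢ n × m ∈ X × n ∈ X

module Schemes (L : Language) where
  open Language L

  infix  25 _≐_
  infixr 20 _⟶_
  infix  30 ~_

  -- The variable metavariable vr i is referred to by its index i.
  data MF : Set where
    mv   : ℕ → MF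
    _≐_  : ℕ → ℕ → MF
    pred : (P : Predicate) → Vec ℕ (arity P) → MF
    all  : ℕ → MF → MF
    ~_   : MF → MF
    _⟶_ : MF → MF → MF

  OC : MF → List MV
  OC (mv i)      = fm i ∷ []
  OC (i ≐ j)     = vr i ∷ vr j ∷ []
  OC (pred P is) = map vr (toList is)
  OC (all i A)   = vr i ∷ OC A
  OC (~ A)       = OC A
  OC (A ⟶ B)     = OC A ++ OC B

  -- Finite sets of metaformulas are lists, compared with _∼[ set ]_.
  record Scheme : Set₁ where
    field
      hyps  : List MF
      concl : MF

    OCs : List MV
    OCs = concatMap OC hyps ++ OC concl

    field
      DV     : Rel MV 0ℓ
      DV-sym : Symmetric DV
      DV⊆𝒫₂  : DV ⇒ 𝒫₂ OCs

  open Scheme public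

  -- The scheme whose disjoint variable conditions are the pairs {m,n} such that
  -- R m n or R n m, intersected with 𝒫₂ of the occurring metavariables.
  scheme : List MF → MF → Rel MV 0ℓ → Scheme
  scheme Γ A R = record
    { hyps   = Γ
    ; concl  = A
    ; DV     = λ m n → 𝒫₂ X m n × (R m n ⊎ R n m)
    ; DV-sym = λ where ((m≢n , m∈ , n∈) , r) → (≢-sym m≢n , n∈ , m∈) , swap r
    ; DV⊆𝒫₂  = proj₁
    }
    where X = concatMap OC Γ ++ OC A

  infix 4 _≈_
  _≈_ : Rel Scheme 0ℓ
  Φ ≈ Ψ = hyps Φ ∼[ set ] hyps Ψ
        × concl Φ ≡ concl Ψ
        × (∀ m n → DV Φ m n ⇔ DV Ψ m n)

  SchemeSet : Set₂
  SchemeSet = Unary.Pred Scheme (lsuc 0ℓ)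

  ⟪_⟫ : List Scheme → SchemeSet
  ⟪ Φs ⟫ Φ = Any (Φ ≈_) Φs

  record Substitution : Set where
    field
      onVr     : ℕ → ℕ
      onFm     : ℕ → MF
      support  : List MV
      vr-fixed : ∀ i → vr i ∉ support → onVr i ≡ i
      fm-fixed : ∀ i → fm i ∉ support → onFm i ≡ mv i

  open Substitution public

  _[_] : MF → Substitution → MF
  mv i      [ σ ] = onFm σ i
  (i ≐ j)   [ σ ] = onVr σ i ≐ onVr σ j
  pred P is [ σ ] = pred P (Vec.map (onVr σ) is)
  all i A   [ σ ] = all (onVr σ i) (A [ σ ])
  (~ A)     [ σ ] = ~ (A [ σ ])
  (A ⟶ B)   [ σ ] = (A [ σ ]) ⟶ (B [ σ ])

  -- OC(σ(m))
  OCimage : Substitution → MV → List MV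
  OCimage σ (vr i) = vr (onVr σ i) ∷ []
  OCimage σ (fm i) = OC (onFm σ i)

  _^_ : Rel MV 0ℓ → Substitution → Rel MV 0ℓ
  (D ^ σ) m n = m ≢ n ×
    ∃[ m′ ] ∃[ n′ ] (D m′ n′ × m ∈ OCimage σ m′ × n ∈ OCimage σ n′)

  Legitimate : Substitution → Scheme → Set
  Legitimate σ Φ = ∀ {m n} → DV Φ m n → Disjoint (OCimage σ m) (OCimage σ n)

  _InstanceOf_ : Scheme → Scheme → Set
  Ψ InstanceOf Φ = ∃[ σ ]
    ( Legitimate σ Φ
    × hyps Ψ ∼[ set ] map (_[ σ ]) (hyps Φ)
    × concl Ψ ≡ concl Φ [ σ ]
    × (DV Φ ^ σ) ⇒ DV Ψ )

  OCproof : ∀ {n} → Scheme → Vector MF n → List MV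
  OCproof {n} Φ P = OCs Φ ++ concatMap (OC ∘ P) (allFin n)

  -- DV(P), up to symmetrization, which scheme performs where this is used.
  DVproof : ∀ {n} → Scheme → Vector MF n → Rel MV 0ℓ
  DVproof Φ P m n =
    DV Φ m n ⊎ (m ∈ OCproof Φ P × m ∉ OCs Φ × n ∈ OCproof Φ P × m ≢ n)

  JustifiedBy : ∀ {n} → SchemeSet → Scheme → Vector MF n → Fin n → Set₁
  JustifiedBy {n} S Φ P i =
    ∃[ js ] ( All (Fin._< i) js
            × ∃[ Ψ ] (S Ψ × scheme (map P js) (P i) (DVproof Φ P) InstanceOf Ψ) )

  record Proof (S : SchemeSet) (Φ : Scheme) : Set₁ where
    field
      n         : ℕ
      line      : Vector MF (suc n)
      last-line : line (fromℕ n) ≡ concl Φ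
      justified : ∀ i → line i ∈ hyps Φ ⊎ JustifiedBy S Φ line i

  Provable : SchemeSet → Scheme → Set₁
  Provable S Φ = Proof S Φ

  IndependentIn : Scheme → SchemeSet → Set₁
  IndependentIn Φ S = S Φ × ¬ Provable (S Unary.∖ ⟪ Φ ∷ [] ⟫) Φ

  infix 4 _⟹_,DV_
  _⟹_,DV_ : List MF → MF → List (MV × MV) → Scheme
  Γ ⟹ A ,DV D = scheme Γ A (λ m n → (m , n) ∈ D)

  infix 4 _⟹_
  _⟹_ : List MF → MF → Scheme
  Γ ⟹ A = Γ ⟹ A ,DV []

  x y z : ℕ
  x = 0
  y = 1
  z = 2

  φ ψ χ θ τ : MF
  φ = mv 0
  ψ = mv 1
  χ = mv 2
  θ = mv 3
  τ = mv 4

  x̂ ŷ φ̂ : MV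
  x̂ = vr x
  ŷ = vr y
  φ̂ = fm 0

  mp minimp peirce contrap notelim gen ALLdistr spec modal5 vacGen
    EQrefl EQsymm EQtrans denot subst ALLeq genEq : Scheme
  mp       = φ ∷ (φ ⟶ ψ) ∷ [] ⟹ ψ
  minimp   = [] ⟹ φ ⟶ ((ψ ⟶ χ) ⟶ (((θ ⟶ ψ) ⟶ (χ ⟶ τ)) ⟶ (ψ ⟶ τ)))
  peirce   = [] ⟹ ((φ ⟶ ψ) ⟶ φ) ⟶ φ
  contrap  = [] ⟹ (φ ⟶ ~ ψ) ⟶ (ψ ⟶ ~ φ)
  notelim  = [] ⟹ ~ φ ⟶ (φ ⟶ ψ)
  gen      = φ ∷ [] ⟹ all x φ
  ALLdistr = [] ⟹ all x (φ ⟶ ψ) ⟶ (all x φ ⟶ all x ψ)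
  spec     = [] ⟹ all x φ ⟶ φ
  modal5   = [] ⟹ ~ all x φ ⟶ all x (~ all x φ)
  vacGen   = [] ⟹ φ ⟶ all x φ ,DV ((x̂ , φ̂) ∷ [])
  EQrefl   = [] ⟹ x ≐ x
  EQsymm   = [] ⟹ x ≐ y ⟶ y ≐ x
  EQtrans  = [] ⟹ x ≐ y ⟶ (y ≐ z ⟶ x ≐ z)
  denot    = [] ⟹ x ≐ x ⟶ ~ all y (~ (y ≐ x)) ,DV ((x̂ , ŷ) ∷ [])
  subst    = [] ⟹ all x (x ≐ y ⟶ (φ ⟶ all x (x ≐ y ⟶ φ)))
               ,DV ((x̂ , ŷ) ∷ (ŷ , φ̂) ∷ [])
  ALLeq    = [] ⟹ all x (x ≐ y) ⟶ (all x φ ⟶ all y φ)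
  genEq    = [] ⟹ ~ all x (x ≐ y) ⟶ (~ all x (x ≐ z) ⟶ (y ≐ z ⟶ all x (y ≐ z)))

  ALLcommDV : List (MV × MV) → Scheme
  ALLcommDV D = [] ⟹ all x (all y φ) ⟶ all y (all x φ) ,DV D

  ALLcomm : Scheme
  ALLcomm = ALLcommDV []

  TMM : SchemeSet
  TMM = ⟪ mp ∷ minimp ∷ peirce ∷ contrap ∷ notelim ∷ gen ∷ ALLdistr ∷ spec
        ∷ modal5 ∷ vacGen ∷ ALLcomm ∷ EQrefl ∷ EQsymm ∷ EQtrans ∷ denot
        ∷ subst ∷ ALLeq ∷ genEq ∷ [] ⟫

{-# OPTIONS --safe #-}
-- Interpret formulas in a model with two worlds, false and true, in which every
-- quantifier evaluates its body at a single world: ∀x at the world false, ∀y at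
-- the world true, and every other quantifier at the current world. Atoms are true,
-- except that φ holds exactly at the world true and all other formula metavariables
-- are false. Then ∀x∀yφ is true and ∀y∀xφ is false. Since evaluation at a fixed
-- world is idempotent and commutes with the connectives, only the schemes with
-- disjoint variable conditions and ALLcomm need care. In a proof of ALLcomm no
-- condition relates two of x, y, φ, all other quantifiers are void, and a formula
-- avoiding x, y, φ has the same value at both worlds.
module Submission where

open import Defs
open import Data.Bool.Base using (Bool; true; false; not; _∨_)
open import Data.Fin.Base using (Fin; fromℕ)
import Data.Fin.Base as Fin
open import Data.Fin.Induction using (<-wellFounded)
open import Data.List.Base using ([]; _∷_; map)
open import Data.List.Membership.Propositional using (_∈_)
open import Data.List.Membership.Propositional.Properties
  using (∈-map⁺; ∈-map⁻; ∈-++⁺ˡ; ∈-++⁺ʳ)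
open import Data.List.Relation.Unary.All as All using ([]; _∷_)
open import Data.List.Relation.Unary.Any using (here; there)
open import Data.Nat.Base using (ℕ; zero; suc)
open import Data.Product.Base using (_×_; _,_)
open import Data.Sum.Base using (_⊎_; inj₁; inj₂)
open import Function.Base using (_∘_; _$_)
open import Function.Bundles using (Equivalence)
open import Function.Construct.Identity using (⇔-id)
import Induction.WellFounded as WF
open import Level using (0ℓ)
open import Relation.Binary.PropositionalEquality
  using (_≡_; refl; sym; trans; cong; cong₂)
  renaming (subst to ≡-subst)
open import Relation.Nullary using (¬_; contradiction)
open import Relation.Unary using (_∪_; _∖_; _⊆_)

infixr 5 _⊃_
_⊃_ : Bool → Bool → Bool
a ⊃ b = not a ∨ b

⊃-intro : ∀ {a b} → (a ≡ true → b ≡ true) → (a ⊃ b) ≡ true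
⊃-intro {false} _ = refl
⊃-intro {true}  f = f refl

⊃-elim : ∀ {a b} → (a ⊃ b) ≡ true → a ≡ true → b ≡ true
⊃-elim p refl = p

≡⇒⊃ : ∀ {a b} → a ≡ b → (a ⊃ b) ≡ true
≡⇒⊃ a≡b = ⊃-intro (trans (sym a≡b))

⊃-minimp : ∀ a b c d e →
  (a ⊃ ((b ⊃ c) ⊃ (((d ⊃ b) ⊃ (c ⊃ e)) ⊃ (b ⊃ e)))) ≡ true
⊃-minimp a b c d e =
  ⊃-intro {a} λ _ → ⊃-intro {b ⊃ c} λ bc → ⊃-intro {(d ⊃ b) ⊃ (c ⊃ e)} λ h →
  ⊃-intro {b} λ p →
  ⊃-elim {c} (⊃-elim {d ⊃ b} h (⊃-intro {d} λ _ → p)) (⊃-elim {b} bc p)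

⊃-peirce : ∀ a b → (((a ⊃ b) ⊃ a) ⊃ a) ≡ true
⊃-peirce false _     = refl
⊃-peirce true  false = refl
⊃-peirce true  true  = refl

⊃-contrap : ∀ a b → ((a ⊃ not b) ⊃ (b ⊃ not a)) ≡ true
⊃-contrap false false = refl
⊃-contrap false true  = refl
⊃-contrap true  false = refl
⊃-contrap true  true  = refl

⊃-notelim : ∀ a b → (not a ⊃ (a ⊃ b)) ≡ true
⊃-notelim false _ = refl
⊃-notelim true  _ = refl

move : ℕ → Bool → Bool
move 0             _ = false
move 1             _ = true
move (suc (suc _)) w = w

move-idem : ∀ i w → move i (move i w) ≡ move i w
move-idem 0             _ = refl
move-idem 1             _ = refl
move-idem (suc (suc _)) _ = refl

module TwoWorlds (L : Language) where
  open Schemes L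

  eval : MF → Bool → Bool
  eval (mv zero)    w = w
  eval (mv (suc _)) _ = false
  eval (_ ≐ _)      _ = true
  eval (pred _ _)   _ = true
  eval (all i A)    w = eval A (move i w)
  eval (~ A)        w = not (eval A w)
  eval (A ⟶ B)      w = eval A w ⊃ eval B w

  Valid : MF → Set
  Valid A = ∀ w → eval A w ≡ true

  ALLcomm-invalid : ¬ Valid (concl ALLcomm)
  -- The innermost quantifier fixes the world, so the antecedent reads `φ` at `true` and the
  -- consequent reads it at `false`, whatever the starting world.
  ALLcomm-invalid valid with () ← valid true

  -- These are x, y and φ, the only metavariables whose interpretation changes or reads the current
  -- world.
  Special : MV → Set
  Special m = m ∈ OCs ALLcomm

  special⊎void : ∀ i → Special (vr i) ⊎ (∀ w → move i w ≡ w)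
  special⊎void 0             = inj₁ (here refl)
  special⊎void 1             = inj₁ (there (here refl))
  special⊎void (suc (suc _)) = inj₂ λ _ → refl

  -- Only `mv 0` reads the world; under a quantifier the induction continues at the two moved
  -- worlds.
  eval-constant : ∀ A → (∀ {m} → m ∈ OC A → ¬ Special m) →
                  ∀ v w → eval A v ≡ eval A w
  eval-constant (mv zero)    h _ _ =
    contradiction (there (there (here refl))) (h (here refl))
  eval-constant (mv (suc _)) _ _ _ = refl
  eval-constant (_ ≐ _)      _ _ _ = refl
  eval-constant (pred _ _)   _ _ _ = refl
  eval-constant (all i A)    h v w = eval-constant A (h ∘ there) (move i v) (move i w)
  eval-constant (~ A)        h v w = cong not (eval-constant A h v w)
  eval-constant (A ⟶ B)      h v w =
    cong₂ _⊃_ (eval-constant A (h ∘ ∈-++⁺ˡ) v w)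
              (eval-constant B (h ∘ ∈-++⁺ʳ (OC A)) v w)

  -- What the DV conditions of Ψ amount to in a proof of ALLcomm.
  Separates : Substitution → Scheme → Set
  Separates σ Ψ = ∀ {m n p q} → DV Ψ m n →
    p ∈ OCimage σ m → q ∈ OCimage σ n → ¬ (Special p × Special q)

  -- Premises are assumed at both worlds because `gen` evaluates its premise at a moved world.
  Sound : Scheme → Set
  Sound Ψ = ∀ σ → Separates σ Ψ →
    (∀ {A} → A ∈ hyps Ψ → Valid (A [ σ ])) → Valid (concl Ψ [ σ ])

  Sound-resp-≈ : ∀ {Φ Ψ} → Ψ ≈ Φ → Sound Φ → Sound Ψ
  Sound-resp-≈ (hyps≈ , refl , DV≈) sound σ sep valid =
    sound σ (sep ∘ Equivalence.from (DV≈ _ _)) (valid ∘ Equivalence.from hyps≈)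

  -- `ALLcomm` carries no conditions itself, so every condition in its proof involves a metavariable
  -- foreign to it.
  DV⇒¬special : ∀ {n} Γ A (P : Fin n → MF) {m m′} →
    DV (scheme Γ A (DVproof ALLcomm P)) m m′ → ¬ (Special m × Special m′)
  DV⇒¬special _ _ _ (_ , inj₁ (inj₁ (_ , inj₁ ())))
  DV⇒¬special _ _ _ (_ , inj₁ (inj₁ (_ , inj₂ ())))
  DV⇒¬special _ _ _ (_ , inj₂ (inj₁ (_ , inj₁ ())))
  DV⇒¬special _ _ _ (_ , inj₂ (inj₁ (_ , inj₂ ())))
  DV⇒¬special _ _ _ (_ , inj₁ (inj₂ (_ , m∉ , _)))  (m∈ , _)  = m∉ m∈
  DV⇒¬special _ _ _ (_ , inj₂ (inj₂ (_ , m′∉ , _))) (_ , m′∈) = m′∉ m′∈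

  sound⇒¬Provable : ∀ {S} → S ⊆ Sound → ¬ Provable S ALLcomm
  sound⇒¬Provable {S} sound pf =
    ALLcomm-invalid (≡-subst Valid last-line (valid (fromℕ n)))
    where
    open Proof pf

    step : ∀ i → (∀ {j} → j Fin.< i → Valid (line j)) → Valid (line i)
    step i ih with justified i
    -- No line is a hypothesis, since `ALLcomm` has none.
    ... | inj₂ (js , js<i , Ψ , SΨ , σ , legit , hyps≈ , concl≡ , DV⊆) =
      ≡-subst Valid (sym concl≡) (sound SΨ σ separates premises)
      where
      separates : Separates σ Ψ
      separates d p∈ q∈ =
        DV⇒¬special (map line js) (line i) line $
        -- Legitimacy of `σ` makes the two metavariables distinct, as membership in `DV Ψ ^ σ`
        -- requires.
        DV⊆ ((λ { refl → legit d (p∈ , q∈) }) , _ , _ , d , p∈ , q∈)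

      premises : ∀ {A} → A ∈ hyps Ψ → Valid (A [ σ ])
      premises A∈ with ∈-map⁻ line (Equivalence.from hyps≈ (∈-map⁺ (_[ σ ]) A∈))
      ... | j , j∈js , A≡ = ≡-subst Valid (sym A≡) (ih (All.lookup js<i j∈js))

    valid : ∀ i → Valid (line i)
    valid = wfRec _ step
      where open WF.All <-wellFounded 0ℓ

  -- Either the quantifier is void, or its variable is x or y and the condition keeps x, y and φ out
  -- of the body, which is then constant.
  vacGen-sound : Sound vacGen
  vacGen-sound σ sep _ w with special⊎void (onVr σ x)
  ... | inj₂ void = ≡⇒⊃ (cong (eval (onFm σ 0)) (sym (void w)))
  ... | inj₁ x∈   = ≡⇒⊃ (eval-constant (onFm σ 0) avoids w _)
    where
    avoids : ∀ {m} → m ∈ OC (onFm σ 0) → ¬ Special m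
    avoids m∈ m-special =
      sep {x̂} {φ̂} (((λ ()) , there (here refl) , here refl) , inj₁ (here refl))
        (here refl) m∈ (x∈ , m-special)

  -- At least one of the two moves is the identity.
  moves-commute : ∀ i j → ¬ (Special (vr i) × Special (vr j)) →
                  ∀ w → move j (move i w) ≡ move i (move j w)
  moves-commute i j h w with special⊎void i | special⊎void j
  ... | inj₁ i∈   | inj₁ j∈   = contradiction (i∈ , j∈) h
  ... | inj₂ void | _         = trans (cong (move j) (void w)) (sym (void _))
  ... | inj₁ _    | inj₂ void = trans (void _) (cong (move i) (sym (void w)))

  ALLcommDV-xy-sound : Sound (ALLcommDV ((x̂ , ŷ) ∷ []))
  ALLcommDV-xy-sound σ sep _ w =
    ≡⇒⊃ (cong (eval (onFm σ 0)) (moves-commute (onVr σ x) (onVr σ y) ¬both w))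
    where
    ¬both : ¬ (Special (vr (onVr σ x)) × Special (vr (onVr σ y)))
    ¬both = sep {x̂} {ŷ}
      (((λ ()) , here refl , there (here refl)) , inj₁ (here refl))
      (here refl) (here refl)

  -- The same dichotomy as for `vacGen`, applied to the image of y.
  ALLcommDV-yφ-sound : Sound (ALLcommDV ((ŷ , φ̂) ∷ []))
  ALLcommDV-yφ-sound σ sep _ w with special⊎void (onVr σ y)
  ... | inj₂ void =
    ≡⇒⊃ (cong (eval (onFm σ 0))
      (trans (void _) (cong (move (onVr σ x)) (sym (void w)))))
  ... | inj₁ y∈   = ≡⇒⊃ (eval-constant (onFm σ 0) avoids _ _)
    where
    avoids : ∀ {m} → m ∈ OC (onFm σ 0) → ¬ Special m
    avoids m∈ m-special =
      sep {ŷ} {φ̂}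
        (((λ ()) , there (here refl) , there (there (here refl))) , inj₁ (here refl))
        (here refl) m∈ (y∈ , m-special)

  TMM-sound : TMM ∖ ⟪ spec ∷ ALLeq ∷ ALLcomm ∷ [] ⟫ ⊆ Sound
  TMM-sound {Ψ} (Ψ∈TMM , Ψ∉) = All.lookupWith {P = SoundOrExcluded} (λ {Φ} → use {Φ})
    -- The entries follow the order of `TMM`. In `modal5` and `subst` a repeated move has no further
    -- effect; the cases closed by a bare `refl` compute to `true` because equations are true.
    ( inj₁ (λ σ _ valid w →
        ⊃-elim {eval (onFm σ 0) w} (valid (there (here refl)) w) (valid (here refl) w))
    ∷ inj₁ (λ σ _ _ w → ⊃-minimp (v σ 0 w) (v σ 1 w) (v σ 2 w) (v σ 3 w) (v σ 4 w))
    ∷ inj₁ (λ σ _ _ w → ⊃-peirce (v σ 0 w) (v σ 1 w))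
    ∷ inj₁ (λ σ _ _ w → ⊃-contrap (v σ 0 w) (v σ 1 w))
    ∷ inj₁ (λ σ _ _ w → ⊃-notelim (v σ 0 w) (v σ 1 w))
    ∷ inj₁ (λ σ _ valid w → valid (here refl) (move (onVr σ x) w))
    ∷ inj₁ (λ σ _ _ w → ≡⇒⊃ {v σ 0 (move (onVr σ x) w) ⊃ _} refl)
    ∷ inj₂ (λ Ψ≈ → here Ψ≈)
    ∷ inj₁ (λ σ _ _ w → ≡⇒⊃ (cong (not ∘ v σ 0) (sym (move-idem (onVr σ x) _))))
    ∷ inj₁ vacGen-sound
    ∷ inj₂ (λ Ψ≈ → there (there (here Ψ≈)))
    ∷ inj₁ (λ _ _ _ _ → refl)
    ∷ inj₁ (λ _ _ _ _ → refl)
    ∷ inj₁ (λ _ _ _ _ → refl)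
    ∷ inj₁ (λ _ _ _ _ → refl)
    ∷ inj₁ (λ σ _ _ w → ≡⇒⊃ (cong (v σ 0) (sym (move-idem (onVr σ x) w))))
    ∷ inj₂ (λ Ψ≈ → there (here Ψ≈))
    ∷ inj₁ (λ _ _ _ _ → refl)
    ∷ [] ) Ψ∈TMM
    where
    v : Substitution → ℕ → Bool → Bool
    v σ i = eval (onFm σ i)

    SoundOrExcluded : Scheme → Set₁
    SoundOrExcluded Φ =
      Sound Φ ⊎ (Ψ ≈ Φ → ⟪ spec ∷ ALLeq ∷ ALLcomm ∷ [] ⟫ Ψ)

    use : ∀ {Φ} → SoundOrExcluded Φ → Ψ ≈ Φ → Sound Ψ
    use {Φ} (inj₁ sound) Ψ≈ = Sound-resp-≈ {Φ} {Ψ} Ψ≈ sound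
    use (inj₂ excluded) Ψ≈ = contradiction (excluded Ψ≈) Ψ∉

  ALLcomm∈TMM∖spec,ALLeq : (TMM ∖ ⟪ spec ∷ ALLeq ∷ [] ⟫) ALLcomm
  ALLcomm∈TMM∖spec,ALLeq =
    there (there (there (there (there (there (there (there (there (there
      (here (⇔-id _ , refl , λ _ _ → ⇔-id _)))))))))))
    , λ where
        (here (_ , () , _))
        (there (here (_ , () , _)))

proposition3p9 : (L : Language) → let open Schemes L in
    (∀ D → D ∈ (x̂ , ŷ) ∷ (ŷ , φ̂) ∷ [] →
    ¬ Provable ((TMM ∖ ⟪ spec ∷ ALLeq ∷ ALLcomm ∷ [] ⟫) ∪ ⟪ ALLcommDV (D ∷ []) ∷ [] ⟫) ALLcomm)
    × IndependentIn ALLcomm (TMM ∖ ⟪ spec ∷ ALLeq ∷ [] ⟫)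
proposition3p9 L =
  (λ D D∈ → sound⇒¬Provable
    λ { {Ψ} (inj₁ Ψ∈)        → TMM-sound {Ψ} Ψ∈
      ; {Ψ} (inj₂ (here Ψ≈)) →
          Sound-resp-≈ {ALLcommDV (D ∷ [])} {Ψ} Ψ≈ (weakened-sound D∈) })
  , ALLcomm∈TMM∖spec,ALLeq
  -- The two successive removals are merged into the removal of all three schemes at once.
  , sound⇒¬Provable λ { {Ψ} ((Ψ∈TMM , Ψ∉) , Ψ≉) → TMM-sound {Ψ} (Ψ∈TMM , λ where
      (here Ψ≈)                 → Ψ∉ (here Ψ≈)
      (there (here Ψ≈))         → Ψ∉ (there (here Ψ≈))
      (there (there (here Ψ≈))) → Ψ≉ (here Ψ≈)) }
  where
  open Schemes L
  open TwoWorlds L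

  weakened-sound : ∀ {D} → D ∈ (x̂ , ŷ) ∷ (ŷ , φ̂) ∷ [] → Sound (ALLcommDV (D ∷ []))
  weakened-sound (here refl)         = ALLcommDV-xy-sound
  weakened-sound (there (here refl)) = ALLcommDV-yφ-sound
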